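{- There exists an absolute constant $c>0$ such that the following holds. Let $t$ be a positive integer; then there is $\alpha=\alpha(t)>0$ such that every quasi-comparability graph $G$ of complexity $t$ on $n$ vertices contains either a clique or an independent set of size at least $\alpha n^{c}$.
   Context: For $\mathbf{x},\mathbf{y}\in\mathbb{R}^t$ write $\mathbf{x}\prec\mathbf{y}$ if $\mathbf{x}(i)<\mathbf{y}(i)$ for every $i\in[t]$. A graph $G$ is a quasi-comparability graph of complexity $t$ if $V(G)$ is a finite subset of $\mathbb{R}^t\times\mathbb{R}^t$ and two distinct vertices $(\mathbf{x},\mathbf{y})$ and $(\mathbf{x}',\mathbf{y}')$ are adjacent iff $\mathbf{x}\prec\mathbf{y}'$ or $\mathbf{x}'\prec\mathbf{y}$. -}

module Defs where

open import Level using (0ℓ)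
open import Data.Nat using (ℕ; _*_; _^_; _≤_)
open import Data.Fin using (Fin)
open import Data.Fin.Subset using (Subset; _∈_; ∣_∣)
open import Data.Product using (_×_; proj₁; proj₂)
open import Data.Sum using (_⊎_)
open import Relation.Nullary using (¬_)
open import Relation.Binary.PropositionalEquality using (_≢_)
open import Relation.Binary.Bundles using (StrictTotalOrder)

module _ (O : StrictTotalOrder 0ℓ 0ℓ 0ℓ) where
  open StrictTotalOrder O renaming (Carrier to A)

  Point : ℕ → Set
  Point t = Fin t → A

  _≺_ : {t : ℕ} → Point t → Point t → Set
  x ≺ y = ∀ i → x i < y i

  _≈ₚ_ : {t : ℕ} → Point t → Point t → Set
  x ≈ₚ y = ∀ i → x i ≈ y i

  record QCGraph (t n : ℕ) : Set where
    field
      vtx      : Fin n → Point t × Point t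
      distinct : ∀ u v → u ≢ v →
                 ¬ (proj₁ (vtx u) ≈ₚ proj₁ (vtx v) × proj₂ (vtx u) ≈ₚ proj₂ (vtx v))

  -- adjacency of (x,y) and (x',y'): x ≺ y' or x' ≺ y  (for distinct vertices)
  Adj : {t n : ℕ} → QCGraph t n → Fin n → Fin n → Set
  Adj G u v = (proj₁ (vtx u) ≺ proj₂ (vtx v)) ⊎ (proj₁ (vtx v) ≺ proj₂ (vtx u))
    where open QCGraph G

  IsClique : {t n : ℕ} → QCGraph t n → Subset n → Set
  IsClique G S = ∀ u v → u ∈ S → v ∈ S → u ≢ v → Adj G u v

  IsIndependent : {t n : ℕ} → QCGraph t n → Subset n → Set
  IsIndependent G S = ∀ u v → u ∈ S → v ∈ S → u ≢ v → ¬ Adj G u v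

-- "k ≥ (a/b) · n^(p/q)" for positive naturals a b p q, written without
-- real arithmetic:  a^q · n^p ≤ (b · k)^q.
AtLeastPow : (a b p q n k : ℕ) → Set
AtLeastPow a b p q n k = a ^ q * n ^ p ≤ (b * k) ^ q

{-# OPTIONS --safe #-}
-- Ranking the values of each coordinate, a vertex (x , y) gives in coordinate i an interval of naturals below
-- 2 ^ K with K = O(log n): it is [x i , y i - 1] or [y i , x i], according to which is nonempty. Its cell is the
-- smallest dyadic interval containing it. Two intervals with cells of the same size intersect if the cells
-- coincide and are separated otherwise. So, once the orientations and the cell sizes are fixed in all
-- coordinates (a loss of a factor (2 (K + 1)) ^ t), the relation x ≺ y' between vertices is transitive, and
-- Mirsky's theorem gives a homogeneous set of about the square root of the remaining size. The loss is
-- polylogarithmic, hence O(n ^ (1/2)), which leaves the exponent 1/4.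
module Submission where

open import Defs
open import Level using (0ℓ)
open import Data.Nat using (ℕ; _≥_)
open import Data.Fin.Subset using (Subset; ∣_∣)
open import Data.Product using (∃; Σ; _×_; ∃-syntax)
open import Data.Sum using (_⊎_)
open import Relation.Binary.Bundles using (StrictTotalOrder)

open import Data.Nat
  using (zero; suc; _+_; _*_; _^_; _≤_; _<_; z≤n; s≤s; ⌊_/2⌋; ⌈_/2⌉; _/_; _%_; _≟_; _≤?_; _<?_; NonZero; >-nonZero)
open import Data.Nat.DivMod using (m≡m%n+[m/n]*n; m%n<n; m/n*n≤m)
open import Data.Nat.Properties
open import Data.Nat.Tactic.RingSolver using (solve-∀)
open import Data.Fin using (Fin; zero; suc; toℕ; combine; funToFin; finToFun)
import Data.Fin as Fin
open import Data.Fin.Properties using (all?; toℕ<n; toℕ-injective; combine-injective; finToFun-funToFin)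
import Data.Fin.Properties as Fin
open import Data.Fin.Subset using (⁅_⁆; _∪_; ⊥) renaming (_∈_ to _∈ₛ_)
open import Data.Fin.Subset.Properties
  using (p⊂q⇒∣p∣<∣q∣; q⊆p∪q; p⊆p∪q; x∈p∪q⁻; x∈⁅y⁆⇒x≡y; x∈⁅x⁆; ∉⊥)
open import Data.List using (List; []; _∷_; _++_; length; filter; map; allFin)
open import Data.List.Properties using (length-++; length-map; length-tabulate; length-filter)
open import Data.List.Membership.Propositional using (_∈_; find; lose)
open import Data.List.Membership.Propositional.Properties
  using (∈-filter⁻; ∈-++⁺ˡ; ∈-map⁺; ∈-allFin)
open import Data.List.Relation.Unary.All as All using (All; []; _∷_)
open import Data.List.Relation.Unary.All.Properties using (all-filter)
open import Data.List.Relation.Unary.Any using (Any; here; there; any?)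
open import Data.List.Relation.Unary.AllPairs as AllPairs using (AllPairs; []; _∷_)
open import Data.List.Relation.Unary.Unique.Propositional using (Unique)
open import Data.List.Relation.Unary.Unique.Propositional.Properties using (Unique[x∷xs]⇒x∉xs; allFin⁺)
  renaming (filter⁺ to Unique-filter⁺)
open import Data.Product using (_,_; proj₁; proj₂)
open import Data.Sum using (inj₁; inj₂; [_,_]′) renaming (map to ⊎-map)
open import Function using (_∘_; id)
open import Relation.Nullary using (¬_; Dec; yes; no; contradiction)
open import Relation.Nullary.Decidable using (¬?; _×-dec_; _⊎-dec_)
open import Relation.Unary using (Decidable)
open import Relation.Binary using (tri<; tri≈; tri>)
open import Relation.Binary.PropositionalEquality using (_≡_; _≢_; refl; sym; trans; cong)

-- Lists and subsets

module _ {A : Set} {P : A → Set} (P? : Decidable P) where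

  length-filter-¬ : ∀ xs → length xs ≡ length (filter P? xs) + length (filter (¬? ∘ P?) xs)
  length-filter-¬ [] = refl
  length-filter-¬ (x ∷ xs) with P? x
  ... | yes _ = cong suc (length-filter-¬ xs)
  ... | no  _ = trans (cong suc (length-filter-¬ xs)) (sym (+-suc _ _))

  module _ {Q : A → Set} (Q? : Decidable Q) (P⊆Q : ∀ {x} → P x → Q x) where

    length-filter-mono : ∀ xs → length (filter P? xs) ≤ length (filter Q? xs)
    length-filter-mono [] = z≤n
    length-filter-mono (x ∷ xs) with P? x | Q? x
    ... | yes _  | yes _  = s≤s (length-filter-mono xs)
    ... | yes px | no ¬qx = contradiction (P⊆Q px) ¬qx
    ... | no _   | yes _  = m≤n⇒m≤1+n (length-filter-mono xs)
    ... | no _   | no _   = length-filter-mono xs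

    length-filter-mono-< : ∀ {x xs} → x ∈ xs → ¬ P x → Q x →
                           length (filter P? xs) < length (filter Q? xs)
    length-filter-mono-< {xs = x ∷ xs} (here refl) ¬px qx with P? x | Q? x
    ... | yes px | _      = contradiction px ¬px
    ... | no _   | yes _  = s≤s (length-filter-mono xs)
    ... | no _   | no ¬qx = contradiction qx ¬qx
    length-filter-mono-< {xs = y ∷ xs} (there x∈xs) ¬px qx with P? y | Q? y
    ... | yes _  | yes _  = s≤s (length-filter-mono-< x∈xs ¬px qx)
    ... | yes py | no ¬qy = contradiction (P⊆Q py) ¬qy
    ... | no _   | yes _  = m≤n⇒m≤1+n (length-filter-mono-< x∈xs ¬px qx)
    ... | no _   | no _   = length-filter-mono-< x∈xs ¬px qx

-- Induction on `Q`: the class of value `Q` is compared with the class found among the smaller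
-- values, and the longer one is kept.
pigeonhole : {A : Set} (f : A → ℕ) (Q : ℕ) (xs : List A) → Unique xs → All (λ x → f x < Q) xs →
             ∃[ j ] ∃[ ys ] (Unique ys × All (λ x → f x ≡ j) ys × length xs ≤ Q * length ys)
pigeonhole f zero    []       _     _        = 0 , [] , [] , [] , z≤n
pigeonhole f zero    (_ ∷ _)  _     (() ∷ _)
pigeonhole f (suc Q) xs xs! f<1+Q
  with pigeonhole f Q (filter (¬? ∘ (_≟ Q) ∘ f) xs) (Unique-filter⁺ _ xs!)
         (All.tabulate λ x∈ → let x∈xs , fx≢Q = ∈-filter⁻ (¬? ∘ (_≟ Q) ∘ f) x∈
                              in ≤∧≢⇒< (m<1+n⇒m≤n (All.lookup f<1+Q x∈xs)) fx≢Q)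
... | j , zs , zs! , f≡j , rest≤ with ≤-total (length zs) (length (filter ((_≟ Q) ∘ f) xs))
...   | inj₁ zs≤ys = Q , filter ((_≟ Q) ∘ f) xs , Unique-filter⁺ _ xs! , all-filter _ xs ,
        ≤-trans (≤-reflexive (length-filter-¬ ((_≟ Q) ∘ f) xs))
          (+-monoʳ-≤ _ (≤-trans rest≤ (*-monoʳ-≤ Q zs≤ys)))
...   | inj₂ ys≤zs = j , zs , zs! , f≡j ,
        ≤-trans (≤-reflexive (length-filter-¬ ((_≟ Q) ∘ f) xs)) (+-mono-≤ ys≤zs rest≤)

fromList : ∀ {n} → List (Fin n) → Subset n
fromList []       = ⊥
fromList (x ∷ xs) = ⁅ x ⁆ ∪ fromList xs

∈-fromList⁻ : ∀ {n x} (xs : List (Fin n)) → x ∈ₛ fromList xs → x ∈ xs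
∈-fromList⁻ []       x∈ = contradiction x∈ ∉⊥
∈-fromList⁻ (y ∷ xs) x∈ =
  [ here ∘ x∈⁅y⁆⇒x≡y y , there ∘ ∈-fromList⁻ xs ]′ (x∈p∪q⁻ ⁅ y ⁆ (fromList xs) x∈)

length≤∣fromList∣ : ∀ {n} {xs : List (Fin n)} → Unique xs → length xs ≤ ∣ fromList xs ∣
length≤∣fromList∣ []                       = z≤n
length≤∣fromList∣ {xs = x ∷ xs} xs!@(_ ∷ u) = ≤-<-trans (length≤∣fromList∣ u)
  (p⊂q⇒∣p∣<∣q∣ (q⊆p∪q ⁅ x ⁆ (fromList xs) ,
    x , p⊆p∪q (fromList xs) (x∈⁅x⁆ x) , Unique[x∷xs]⇒x∉xs xs! ∘ ∈-fromList⁻ xs))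

-- Mirsky's theorem

module _ {A : Set} (_⊏_ : A → A → Set) (_⊏?_ : ∀ u v → Dec (u ⊏ v))
         (⊏-trans : ∀ {u v w} → u ⊏ v → v ⊏ w → u ⊏ w) where

  Chain : List A → Set
  Chain = AllPairs _⊏_

  Antichain : List A → Set
  Antichain xs = ∀ u v → u ∈ xs → v ∈ xs → ¬ u ⊏ v

  -- Induction on `a`. The elements with nothing of `xs` below them form an antichain. If it has at
  -- most `b` elements, it is removed; a chain found in the rest then extends downwards, since its
  -- first element has something of `xs` below it.
  mirsky : ∀ a b xs → Unique xs → a * b < length xs →
           (∃[ c ] (Chain c × All (_∈ xs) c × a < length c)) ⊎
           (∃[ c ] (Antichain c × Unique c × All (_∈ xs) c × b < length c))
  mirsky zero    b (x ∷ xs) _ _ = inj₁ (x ∷ [] , [] ∷ [] , here refl ∷ [] , s≤s z≤n)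
  mirsky (suc a) b xs xs! large = go (b <? length minimal)
    where
    HasLower : A → Set
    HasLower v = Any (_⊏ v) xs
    hasLower? : Decidable HasLower
    hasLower? v = any? (_⊏? v) xs
    rest minimal : List A
    rest    = filter hasLower? xs
    minimal = filter (¬? ∘ hasLower?) xs

    extend : ∃[ c ] (Chain c × All (_∈ rest) c × a < length c) →
             ∃[ c ] (Chain c × All (_∈ xs) c × suc a < length c)
    extend (z ∷ c , z⊏c ∷ c-chain , z∈ ∷ c∈ , a<)
      with find (proj₂ (∈-filter⁻ hasLower? {xs = xs} z∈))
    ... | u , u∈xs , u⊏z =
      u ∷ z ∷ c , (u⊏z ∷ All.map (⊏-trans u⊏z) z⊏c) ∷ z⊏c ∷ c-chain ,
      u∈xs ∷ All.map (proj₁ ∘ ∈-filter⁻ hasLower? {xs = xs}) (z∈ ∷ c∈) , s≤s a<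

    weaken : ∃[ c ] (Antichain c × Unique c × All (_∈ rest) c × b < length c) →
             ∃[ c ] (Antichain c × Unique c × All (_∈ xs) c × b < length c)
    weaken (c , anti , c! , c∈ , b<) =
      c , anti , c! , All.map (proj₁ ∘ ∈-filter⁻ hasLower? {xs = xs}) c∈ , b<

    go : Dec (b < length minimal) → _
    go (yes b<) = inj₂ (minimal ,
      (λ _ _ u∈ v∈ u⊏v → proj₂ (∈-filter⁻ (¬? ∘ hasLower?) {xs = xs} v∈)
        (lose (proj₁ (∈-filter⁻ (¬? ∘ hasLower?) {xs = xs} u∈)) u⊏v)) ,
      Unique-filter⁺ _ xs! , All.tabulate (proj₁ ∘ ∈-filter⁻ (¬? ∘ hasLower?) {xs = xs}) , b<)
    go (no b≮) = ⊎-map extend weaken (mirsky a b rest (Unique-filter⁺ _ xs!)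
      (+-cancelˡ-< b (a * b) (length rest) (<-≤-trans large
        (≤-trans (≤-reflexive (trans (length-filter-¬ hasLower? xs) (+-comm (length rest) _)))
          (+-monoˡ-≤ (length rest) (≮⇒≥ b≮))))))

-- For positive `N`, `suc r` is the square root rounded up. The bound `r * r < N` lets `mirsky` run
-- with `a = b = r`, and more than `r` elements are then enough.
ceilSqrt : ∀ N → N ≡ 0 ⊎ ∃[ r ] (r * r < N × N ≤ suc r * suc r)
ceilSqrt zero = inj₁ refl
ceilSqrt (suc N) with ceilSqrt N
... | inj₁ refl = inj₂ (0 , s≤s z≤n , s≤s z≤n)
... | inj₂ (r , lo , hi) with suc N ≤? suc r * suc r
...   | yes hi′ = inj₂ (r , m≤n⇒m≤1+n lo , hi′)
...   | no  ≰   = inj₂ (suc r , ≰⇒> ≰ , ≤-trans (s≤s hi) (*-mono-< (n<1+n (suc r)) (n<1+n (suc r))))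

-- A relation u ⊑ v that is only transitive may hold both ways; breaking such ties by index makes it a strict
-- order with the same comparable pairs.
module _ {n : ℕ} (_⊑_ : Fin n → Fin n → Set) (_⊑?_ : ∀ u v → Dec (u ⊑ v))
         (⊑-trans : ∀ {u v w} → u ⊑ v → v ⊑ w → u ⊑ w) where

  private
    _⊏_ : Fin n → Fin n → Set
    u ⊏ v = u ⊑ v × (¬ v ⊑ u ⊎ u Fin.< v)

    _⊏?_ : ∀ u v → Dec (u ⊏ v)
    u ⊏? v = (u ⊑? v) ×-dec (¬? (v ⊑? u) ⊎-dec (u Fin.<? v))

    ⊏-trans : ∀ {u v w} → u ⊏ v → v ⊏ w → u ⊏ w
    -- A return `w ⊑ u` would, by transitivity, reverse the pair known to be irreversible.
    ⊏-trans (uv , inj₁ ¬vu) (vw , _)        = ⊑-trans uv vw , inj₁ λ wu → ¬vu (⊑-trans vw wu)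
    ⊏-trans (uv , inj₂ _)   (vw , inj₁ ¬wv) = ⊑-trans uv vw , inj₁ λ wu → ¬wv (⊑-trans wu uv)
    ⊏-trans (uv , inj₂ u<v) (vw , inj₂ v<w) = ⊑-trans uv vw , inj₂ (<-trans u<v v<w)

    ⊏⇒≢ : ∀ {u v} → u ⊏ v → u ≢ v
    ⊏⇒≢ (uu , inj₁ ¬uu) refl = ¬uu uu
    ⊏⇒≢ (_  , inj₂ u<u) refl = <-irrefl refl u<u

    ⊑⇒comparable : ∀ {u v} → u ≢ v → u ⊑ v → u ⊏ v ⊎ v ⊏ u
    ⊑⇒comparable {u} {v} u≢v uv with v ⊑? u | Fin.<-cmp u v
    ... | no ¬vu | _             = inj₁ (uv , inj₁ ¬vu)
    ... | yes _  | tri< u<v _ _  = inj₁ (uv , inj₂ u<v)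
    ... | yes _  | tri≈ _ u≡v _  = contradiction u≡v u≢v
    ... | yes vu | tri> _ _ v<u  = inj₂ (vu , inj₂ v<u)

    chain⇒comparable : ∀ {c} → AllPairs _⊏_ c → ∀ u v → u ∈ c → v ∈ c → u ≢ v → u ⊑ v ⊎ v ⊑ u
    chain⇒comparable (_ ∷ _)  _ _ (here refl) (here refl) u≢v = contradiction refl u≢v
    chain⇒comparable (x⊏ ∷ _) _ _ (here refl) (there v∈)  _   = inj₁ (proj₁ (All.lookup x⊏ v∈))
    chain⇒comparable (x⊏ ∷ _) _ _ (there u∈)  (here refl) _   = inj₂ (proj₁ (All.lookup x⊏ u∈))
    chain⇒comparable (_ ∷ p)  u v (there u∈)  (there v∈)  u≢v = chain⇒comparable p u v u∈ v∈ u≢v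

  homogeneous : ∀ xs → Unique xs → ∃[ c ] (Unique c × All (_∈ xs) c × length xs ≤ length c * length c ×
    ((∀ u v → u ∈ c → v ∈ c → u ≢ v → u ⊑ v ⊎ v ⊑ u) ⊎
     (∀ u v → u ∈ c → v ∈ c → u ≢ v → ¬ u ⊑ v)))
  homogeneous xs xs! with ceilSqrt (length xs)
  ... | inj₁ xs≡[] = [] , [] , [] , ≤-reflexive xs≡[] , inj₁ λ _ _ ()
  ... | inj₂ (r , lo , hi) with mirsky _⊏_ _⊏?_ ⊏-trans r r xs xs! lo
  ...   | inj₁ (c , chain , c∈ , r<) =
    c , AllPairs.map ⊏⇒≢ chain , c∈ , ≤-trans hi (*-mono-≤ r< r<) , inj₁ (chain⇒comparable chain)
  ...   | inj₂ (c , anti , c! , c∈ , r<) =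
    c , c! , c∈ , ≤-trans hi (*-mono-≤ r< r<) ,
    inj₂ λ u v u∈ v∈ u≢v uv → [ anti u v u∈ v∈ , anti v u v∈ u∈ ]′ (⊑⇒comparable u≢v uv)

-- Dyadic cells

-- The smallest dyadic interval containing l and r is [m * 2 ^ k , (m + 1) * 2 ^ k - 1].
data Cell (l r : ℕ) : (k m : ℕ) → Set where
  point : ∀ {m} → l ≡ m → r ≡ m → Cell l r 0 m
  halve : ∀ {k m} → l < r → Cell ⌊ l /2⌋ ⌊ r /2⌋ k m → Cell l r (suc k) m

⌊n/2⌋-cancel-< : ∀ {m n} → ⌊ m /2⌋ < ⌊ n /2⌋ → m < n
⌊n/2⌋-cancel-< lt = ≰⇒> λ n≤m → <⇒≱ lt (⌊n/2⌋-mono n≤m)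

m<2^[1+n]⇒⌊m/2⌋<2^n : ∀ {m} K → m < 2 ^ suc K → ⌊ m /2⌋ < 2 ^ K
m<2^[1+n]⇒⌊m/2⌋<2^n {m} K lt = ≰⇒> λ 2^K≤ → <⇒≱ lt (begin
  2 ^ K + (2 ^ K + 0)   ≡⟨ cong (2 ^ K +_) (+-identityʳ _) ⟩
  2 ^ K + 2 ^ K         ≤⟨ +-mono-≤ 2^K≤ (≤-trans 2^K≤ (⌊n/2⌋≤⌈n/2⌉ m)) ⟩
  ⌊ m /2⌋ + ⌈ m /2⌉     ≡⟨ ⌊n/2⌋+⌈n/2⌉≡n m ⟩
  m                     ∎)
  where open ≤-Reasoning

-- Both endpoints are halved until they agree. Below `2 ^ K` this takes at most `K` halvings, so the
-- level fits in `Fin (suc K)` and can become part of a colour.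
cell : ∀ K {l r} → l ≤ r → r < 2 ^ K → Σ (Fin (suc K)) λ k → ∃ (Cell l r (toℕ k))
cell zero    l≤r r<1 = zero , 0 , point (n<1⇒n≡0 (≤-<-trans l≤r r<1)) (n<1⇒n≡0 r<1)
cell (suc K) {l} {r} l≤r r< with l ≟ r
... | yes l≡r = zero , r , point l≡r refl
... | no  l≢r with cell K (⌊n/2⌋-mono l≤r) (m<2^[1+n]⇒⌊m/2⌋<2^n K r<)
...   | k , m , c = suc k , m , halve (≤∧≢⇒< l≤r l≢r) c

-- A strict inequality between halves lifts to the numbers themselves, so the order of the indices
-- passes back through all the halvings.
cell-separated : ∀ {l r l′ r′ k m m′} → Cell l r k m → Cell l′ r′ k m′ → m < m′ → r < l′
cell-separated (point refl refl) (point refl refl) m<m′ = m<m′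
cell-separated (halve _ c)       (halve _ c′)      m<m′ = ⌊n/2⌋-cancel-< (cell-separated c c′ m<m′)

-- Both intervals meet the two middle elements of the common cell.
cell-crossing : ∀ {l r l′ r′ k m} → Cell l r (suc k) m → Cell l′ r′ (suc k) m → l < r′
cell-crossing {l} {r} {l′} {r′} (halve l<r (point l≡ r≡)) (halve l′<r′ (point l′≡ _)) =
  -- Otherwise `l′ < r′ ≤ l < r` puts `l′` and `r` at distance at least 2, although their halves are
  -- equal.
  ≰⇒> λ r′≤l → <-irrefl (trans l′≡ (sym r≡)) (⌊n/2⌋-mono (≤-trans (s≤s (<-≤-trans l′<r′ r′≤l)) l<r))
cell-crossing (halve _ c@(halve _ _)) (halve _ c′@(halve _ _)) = ⌊n/2⌋-cancel-< (cell-crossing c c′)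

cell-meet : ∀ {l r l′ r′ k m} → Cell l r k m → Cell l′ r′ k m → l ≤ r′
cell-meet (point refl refl) (point refl refl) = ≤-refl
cell-meet c@(halve _ _)     c′@(halve _ _)    = <⇒≤ (cell-crossing c c′)

-- Orientation and cell size in one coordinate

data Shape (x y k : ℕ) : Fin 2 → Set where
  up   : ∀ {y₋ m} → y ≡ suc y₋ → Cell x y₋ k m → Shape x y k zero
  down : ∀ {m} → Cell y x k m → Shape x y k (suc zero)

shape : ∀ K {x y} → x < 2 ^ K → y < 2 ^ K → Σ (Fin 2) λ s → Σ (Fin (suc K)) λ k → Shape x y (toℕ k) s
shape K {x} {y} x< y< with x <? y
shape K {x} {suc y} x< y< | yes (s≤s x≤y) with cell K x≤y (<-trans (n<1+n y) y<)
... | k , _ , c = zero , k , up refl c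
shape K {x} {y} x< y< | no x≮y with cell K (≮⇒≥ x≮y) x<
... | k , _ , c = suc zero , k , down c

cell-≤ : ∀ {l r k m} → Cell l r k m → l ≤ r
cell-≤ (point refl refl) = ≤-refl
cell-≤ (halve l<r _)     = <⇒≤ l<r

cell-mono-≤ : ∀ {l r l′ r′ k m m′} → Cell l r k m → Cell l′ r′ k m′ → l ≤ r′ → m ≤ m′
cell-mono-≤ c c′ l≤r′ = ≮⇒≥ λ m′<m → <⇒≱ (cell-separated c′ c m′<m) l≤r′

cell-mono-< : ∀ {l r l′ r′ k m m′} → Cell l r k m → Cell l′ r′ k m′ → r < l′ → m < m′
cell-mono-< c c′ r<l′ = ≤∧≢⇒< (cell-mono-≤ c c′ (≤-trans (cell-≤ c) (≤-trans (<⇒≤ r<l′) (cell-≤ c′))))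
  λ { refl → <⇒≱ r<l′ (cell-meet c′ c) }

-- At a common level everything is decided by the cell indices: `x < y′` amounts to `m ≤ m′` when
-- both are `up`, and to `m < m′` when both are `down`. Either comparison is transitive.
shape-trans : ∀ {x y x′ y′ x″ y″ k s} → Shape x y k s → Shape x′ y′ k s → Shape x″ y″ k s →
              x < y′ → x′ < y″ → x < y″
shape-trans (up refl c) (up refl c′) (up refl c″) (s≤s x≤y′) (s≤s x′≤y″)
  with m≤n⇒m<n∨m≡n (≤-trans (cell-mono-≤ c c′ x≤y′) (cell-mono-≤ c′ c″ x′≤y″))
... | inj₁ m<m″ = s≤s (≤-trans (cell-≤ c) (≤-trans (<⇒≤ (cell-separated c c″ m<m″)) (cell-≤ c″)))
... | inj₂ refl = s≤s (cell-meet c c″)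
shape-trans (down c) (down c′) (down c″) x<y′ x′<y″ =
  cell-separated c c″ (<-trans (cell-mono-< c c′ x<y′) (cell-mono-< c′ c″ x′<y″))

-- Ranks in a totally ordered set

module Rank (O : StrictTotalOrder 0ℓ 0ℓ 0ℓ) where
  private module O = StrictTotalOrder O

  rank : List O.Carrier → O.Carrier → ℕ
  rank xs a = length (filter (O._<? a) xs)

  -- The inequality is strict because `a` itself is counted below `b` but not below `a`.
  rank-mono-< : ∀ {xs a b} → a ∈ xs → a O.< b → rank xs a < rank xs b
  rank-mono-< {a = a} {b} a∈ a<b =
    length-filter-mono-< (O._<? a) (O._<? b) (λ z<a → O.trans z<a a<b) a∈ (O.irrefl O.Eq.refl) a<b

  rank-cancel-< : ∀ {xs a b} → rank xs a < rank xs b → a O.< b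
  rank-cancel-< {xs} {a} {b} lt with O.compare a b
  ... | tri< a<b _ _ = a<b
  ... | tri≈ _ a≈b _ = contradiction lt
          (≤⇒≯ (length-filter-mono (O._<? b) (O._<? a) (O.<-respʳ-≈ (O.Eq.sym a≈b)) xs))
  ... | tri> _ _ b<a = contradiction lt
          (≤⇒≯ (length-filter-mono (O._<? b) (O._<? a) (λ z<b → O.trans z<b b<a) xs))

-- Colouring the vertices of a quasi-comparability graph

module _ (O : StrictTotalOrder 0ℓ 0ℓ 0ℓ) {t n : ℕ} (G : QCGraph O t n) where
  open QCGraph G
  open Rank O
  private
    module O = StrictTotalOrder O

    px py : Fin n → Point O t
    px = proj₁ ∘ vtx
    py = proj₂ ∘ vtx

    -- First and second points are ranked in one list, so that an `x` can be compared with a `y`;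
    -- every rank is then at most `n + n`.
    values : Fin t → List O.Carrier
    values i = map (λ u → px u i) (allFin n) ++ map (λ u → py u i) (allFin n)

    length-values : ∀ i → length (values i) ≡ n + n
    length-values i rewrite length-++ (map (λ u → px u i) (allFin n)) {map (λ u → py u i) (allFin n)}
      | length-map (λ u → px u i) (allFin n) | length-map (λ u → py u i) (allFin n)
      | length-tabulate {n = n} id = refl

    x y : Fin n → Fin t → ℕ
    x u i = rank (values i) (px u i)
    y u i = rank (values i) (py u i)

  module _ (K : ℕ) (2n<2^K : n + n < 2 ^ K) where
    private
      rank< : ∀ i a → rank (values i) a < 2 ^ K
      rank< i a = ≤-<-trans (≤-trans (length-filter (O._<? a) (values i)) (≤-reflexive (length-values i))) 2n<2^K

      shapeAt : ∀ u i → Σ (Fin 2) λ s → Σ (Fin (suc K)) λ k → Shape (x u i) (y u i) (toℕ k) s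
      shapeAt u i = shape K (rank< i (px u i)) (rank< i (py u i))

      -- The index of the cell stays out: transitivity asks only for equal orientations and levels,
      -- and of these pairs there are only logarithmically many.
      type : Fin n → Fin t → Fin (2 * suc K)
      type u i = combine (proj₁ (shapeAt u i)) (proj₁ (proj₂ (shapeAt u i)))

      colour : Fin n → Fin ((2 * suc K) ^ t)
      colour u = funToFin (type u)

      colour-type : ∀ {u v} → colour u ≡ colour v → ∀ i → type u i ≡ type v i
      colour-type {u} {v} eq i = trans (sym (finToFun-funToFin (type u) i))
        (trans (cong (λ c → finToFun c i) eq) (finToFun-funToFin (type v) i))

      -- Restates the shape of `v` with the orientation and level computed for `u`, since
      -- `shape-trans` wants common ones for its three vertices.
      shapeLike : ∀ {u v} → colour u ≡ colour v → ∀ i →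
                  Shape (x v i) (y v i) (toℕ (proj₁ (proj₂ (shapeAt u i)))) (proj₁ (shapeAt u i))
      shapeLike {u} {v} eq i with combine-injective (proj₁ (shapeAt u i)) (proj₁ (proj₂ (shapeAt u i)))
                                    (proj₁ (shapeAt v i)) (proj₁ (proj₂ (shapeAt v i))) (colour-type eq i)
      ... | s≡ , k≡ rewrite s≡ | k≡ = proj₂ (proj₂ (shapeAt v i))

      _≺′_ : Point O t → Point O t → Set
      p ≺′ q = _≺_ O p q

      _≺′?_ : ∀ p q → Dec (p ≺′ q)
      p ≺′? q = all? λ i → p i O.<? q i

      ≺-trans : ∀ {u v w} → colour u ≡ colour v → colour v ≡ colour w →
                px u ≺′ py v → px v ≺′ py w → px u ≺′ py w
      ≺-trans {u} {v} {w} uv vw u≺v v≺w i = rank-cancel-< {values i}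
        (shape-trans (shapeLike refl i) (shapeLike {u} {v} uv i) (shapeLike {u} {w} (trans uv vw) i)
          (rank-mono-< (x∈values u) (u≺v i)) (rank-mono-< (x∈values v) (v≺w i)))
        where
        x∈values : ∀ u → px u i ∈ values i
        x∈values u = ∈-++⁺ˡ (∈-map⁺ (λ u → px u i) (∈-allFin u))

      -- Including equality of colours makes the relation transitive on all vertices; inside a
      -- colour class it is `px u ≺′ py v`.
      _⊑_ : Fin n → Fin n → Set
      u ⊑ v = colour u ≡ colour v × px u ≺′ py v

      _⊑?_ : ∀ u v → Dec (u ⊑ v)
      u ⊑? v = (colour u Fin.≟ colour v) ×-dec (px u ≺′? py v)

      ⊑-trans : ∀ {u v w} → u ⊑ v → v ⊑ w → u ⊑ w
      ⊑-trans (uv , u≺v) (vw , v≺w) = trans uv vw , ≺-trans uv vw u≺v v≺w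

    private
      clique : ∀ c → (∀ u v → u ∈ c → v ∈ c → u ≢ v → u ⊑ v ⊎ v ⊑ u) → IsClique O G (fromList c)
      clique c rel u v u∈ v∈ u≢v = ⊎-map proj₂ proj₂ (rel u v (∈-fromList⁻ c u∈) (∈-fromList⁻ c v∈) u≢v)

      independent : ∀ c → (∀ u v → u ∈ c → v ∈ c → colour u ≡ colour v) →
                    (∀ u v → u ∈ c → v ∈ c → u ≢ v → ¬ u ⊑ v) → IsIndependent O G (fromList c)
      independent c sameColour ¬rel u v u∈ₛ v∈ₛ u≢v =
        let u∈ = ∈-fromList⁻ c u∈ₛ; v∈ = ∈-fromList⁻ c v∈ₛ in
        [ (λ u≺v → ¬rel u v u∈ v∈ u≢v (sameColour u v u∈ v∈ , u≺v)) ,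
          (λ v≺u → ¬rel v u v∈ u∈ (u≢v ∘ sym) (sameColour v u v∈ u∈ , v≺u)) ]′

    -- A most `(2 * suc K) ^ t` colours leave a class with at least the average size, and
    -- `homogeneous` keeps at least the square root of that class.
    homogeneousSet : Σ (Subset n) λ S → (IsClique O G S ⊎ IsIndependent O G S) ×
                     n ≤ (2 * suc K) ^ t * (∣ S ∣ * ∣ S ∣)
    homogeneousSet =
      let j , ys , ys! , colour≡j , n≤ = pigeonhole (toℕ ∘ colour) ((2 * suc K) ^ t) (allFin n) (allFin⁺ n)
                                           (All.tabulate λ {u} _ → toℕ<n (colour u))
          c , c! , c∈ , ys≤ , hom = homogeneous _⊑_ _⊑?_ ⊑-trans ys ys!
          coloured : ∀ u → u ∈ c → toℕ (colour u) ≡ j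
          coloured u u∈ = All.lookup colour≡j (All.lookup c∈ u∈)
      in fromList c ,
         ⊎-map (clique c)
           (independent c λ u v u∈ v∈ → toℕ-injective (trans (coloured u u∈) (sym (coloured v v∈)))) hom ,
         ≤-trans (≤-trans (≤-reflexive (sym (length-tabulate {n = n} id))) n≤)
           (*-monoʳ-≤ ((2 * suc K) ^ t) (≤-trans ys≤ (*-mono-≤ (length≤∣fromList∣ c!) (length≤∣fromList∣ c!))))

-- Numerical estimates

^-distribʳ-* : ∀ m n o → (m * n) ^ o ≡ m ^ o * n ^ o
^-distribʳ-* m n zero    = refl
^-distribʳ-* m n (suc o) = trans (cong (m * n *_) (^-distribʳ-* m n o)) ([m*n]*[o*p]≡[m*o]*[n*p] m n (m ^ o) (n ^ o))

n<2^n : ∀ n → n < 2 ^ n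
n<2^n zero    = s≤s z≤n
n<2^n (suc n) = ≤-trans (+-mono-≤ (m^n>0 2 n) (n<2^n n)) (≤-reflexive (cong (2 ^ n +_) (sym (+-identityʳ _))))

-- From `suc (x / s) ≤ 2 ^ (x / s)` follows `x ≤ s * 2 ^ (x / s)`; the power `s` turns the last
-- factor into at most `2 ^ x`.
poly≤exp : ∀ s .{{_ : NonZero s}} x → (2 * x) ^ s ≤ (2 * s) ^ s * 2 ^ x
poly≤exp s x = begin
  (2 * x) ^ s                       ≤⟨ ^-monoˡ-≤ s (*-monoʳ-≤ 2 x≤) ⟩
  (2 * (s * 2 ^ (x / s))) ^ s       ≡⟨ cong (_^ s) (sym (*-assoc 2 s _)) ⟩
  (2 * s * 2 ^ (x / s)) ^ s         ≡⟨ ^-distribʳ-* (2 * s) (2 ^ (x / s)) s ⟩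
  (2 * s) ^ s * (2 ^ (x / s)) ^ s   ≡⟨ cong ((2 * s) ^ s *_) (^-*-assoc 2 (x / s) s) ⟩
  (2 * s) ^ s * 2 ^ (x / s * s)     ≤⟨ *-monoʳ-≤ ((2 * s) ^ s) (^-monoʳ-≤ 2 (m/n*n≤m x s)) ⟩
  (2 * s) ^ s * 2 ^ x               ∎
  where
  open ≤-Reasoning
  x≤ : x ≤ s * 2 ^ (x / s)
  x≤ = begin
    x                     ≡⟨ m≡m%n+[m/n]*n x s ⟩
    x % s + x / s * s     ≤⟨ +-monoˡ-≤ (x / s * s) (<⇒≤ (m%n<n x s)) ⟩
    suc (x / s) * s       ≤⟨ *-monoˡ-≤ s (n<2^n (x / s)) ⟩
    2 ^ (x / s) * s       ≡⟨ *-comm (2 ^ (x / s)) s ⟩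
    s * 2 ^ (x / s)       ∎

nextPower : ∀ m → ∃[ K ] (m < 2 ^ K × 2 ^ K ≤ 2 * suc m)
nextPower zero = 0 , s≤s z≤n , s≤s z≤n
nextPower (suc m) with nextPower m
... | K , m<2^K , 2^K≤ with suc m <? 2 ^ K
...   | yes lt = K , lt , ≤-trans 2^K≤ (*-monoʳ-≤ 2 (n≤1+n (suc m)))
...   | no  ≮  = suc K ,
  ≤-trans (s≤s m<2^K) (≤-trans (+-monoˡ-≤ (2 ^ K) (m^n>0 2 K))
    (≤-reflexive (cong (2 ^ K +_) (sym (+-identityʳ _))))) ,
  *-monoʳ-≤ 2 (≤-trans (≮⇒≥ ≮) (n≤1+n (suc m)))

-- The arithmetic left over once `nextPower` has chosen `K` and `homogeneousSet` has given a set of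
-- size `k`; `C` may depend on `t` but not on `n`.
Absorbs : (t C : ℕ) → Set
Absorbs t C = ∀ n → n ≥ 1 → ∀ K k → 2 ^ K ≤ 2 * suc (n + n) →
              n ≤ (2 * suc K) ^ t * (k * k) → n ≤ C * (k * k * (k * k))

-- With `q = (2 * suc K) ^ t`, squaring `n ≤ q * (k * k)` and using `q * q ≤ C * n` allows one
-- factor `n` to be cancelled.
polylog-absorbed : ∀ t → NonZero (t + t) → ∃[ C ] (C ≥ 1 × Absorbs t C)
polylog-absorbed t t+t≢0 = C , C≥1 , bound
  where
  open ≤-Reasoning
  s C : ℕ
  s = t + t
  -- The 12 is 2 * 2 * 3: from `2 ^ suc K = 2 * 2 ^ K`, from `2 ^ K ≤ 2 * suc (n + n)`, and from
  -- `suc (n + n) ≤ 3 * n`.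
  C = 12 * (2 * s) ^ s

  instance
    s≢0 : NonZero s
    s≢0 = t+t≢0

  C≥1 : C ≥ 1
  C≥1 = *-mono-≤ {1} {12} (s≤s z≤n) (m^n>0 (2 * s) {{m*n≢0 2 s}} s)

  swap : ∀ a b c → a * b * c ≡ a * c * b
  swap = solve-∀
  regroup : ∀ a m → a * (2 * (2 * (3 * m))) ≡ 12 * a * m
  regroup = solve-∀
  triple : ∀ m → suc (suc m + suc m) + m ≡ 3 * suc m
  triple = solve-∀

  bound : Absorbs t C
  bound n@(suc n-1) _ K k 2^K≤ n≤ = *-cancelʳ-≤ n _ n (begin
    n * n                               ≤⟨ *-mono-≤ n≤ n≤ ⟩
    q * (k * k) * (q * (k * k))         ≡⟨ [m*n]*[o*p]≡[m*o]*[n*p] q (k * k) q (k * k) ⟩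
    q * q * (k * k * (k * k))           ≤⟨ *-monoˡ-≤ (k * k * (k * k)) q²≤ ⟩
    C * n * (k * k * (k * k))           ≡⟨ swap C n (k * k * (k * k)) ⟩
    C * (k * k * (k * k)) * n           ∎)
    where
    q : ℕ
    q = (2 * suc K) ^ t
    q²≤ : q * q ≤ C * n
    q²≤ = begin
      q * q                                   ≡⟨ sym (^-distribˡ-+-* (2 * suc K) t t) ⟩
      (2 * suc K) ^ s                         ≤⟨ poly≤exp s (suc K) ⟩
      (2 * s) ^ s * (2 * 2 ^ K)               ≤⟨ *-monoʳ-≤ ((2 * s) ^ s) (*-monoʳ-≤ 2 2^K≤) ⟩
      (2 * s) ^ s * (2 * (2 * suc (n + n)))
        ≤⟨ *-monoʳ-≤ ((2 * s) ^ s) (*-monoʳ-≤ 2 (*-monoʳ-≤ 2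
             (≤-trans (m≤m+n _ n-1) (≤-reflexive (triple n-1))))) ⟩
      (2 * s) ^ s * (2 * (2 * (3 * n)))       ≡⟨ regroup ((2 * s) ^ s) n ⟩
      C * n                                   ∎

atLeastPow : ∀ b .{{_ : NonZero b}} n k → n ≤ b * (k * k * (k * k)) → AtLeastPow 1 b 1 4 n k
atLeastPow b n k n≤ = begin
  1 ^ 4 * n ^ 1                       ≡⟨ trans (*-identityˡ (n ^ 1)) (^-identityʳ n) ⟩
  n                                   ≤⟨ n≤ ⟩
  -- Raising `b` to `b ^ 4` lets the constant move inside the fourth power.
  b * (k * k * (k * k))               ≤⟨ *-monoˡ-≤ (k * k * (k * k)) (m≤m*n b (b ^ 3) {{m^n≢0 b 3}}) ⟩
  b ^ 4 * (k * k * (k * k))           ≡⟨ cong (b ^ 4 *_) (fourth k) ⟩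
  b ^ 4 * k ^ 4                       ≡⟨ sym (^-distribʳ-* b k 4) ⟩
  (b * k) ^ 4                         ∎
  where
  open ≤-Reasoning
  fourth : ∀ k → k * k * (k * k) ≡ k * (k * (k * (k * 1)))
  fourth = solve-∀

-- Homogeneous sets of size of order `n ^ (1/4)`

largeHomogeneousSet : ∀ t C → C ≥ 1 → Absorbs t C →
  (O : StrictTotalOrder 0ℓ 0ℓ 0ℓ) (n : ℕ) (G : QCGraph O t n) →
  Σ (Subset n) λ S → (IsClique O G S ⊎ IsIndependent O G S) × AtLeastPow 1 C 1 4 n ∣ S ∣
-- With no vertices the empty set is enough, as `0 ^ 1 = 0`.
largeHomogeneousSet t C C≥1 absorb O zero      G = ⊥ , inj₁ (λ ()) , z≤n
largeHomogeneousSet t C C≥1 absorb O n@(suc _) G =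
  let K , 2n<2^K , 2^K≤ = nextPower (n + n)
      S , hom , n≤      = homogeneousSet O G K 2n<2^K
  in S , hom , atLeastPow C {{>-nonZero C≥1}} n ∣ S ∣ (absorb n (s≤s z≤n) K ∣ S ∣ 2^K≤ n≤)

theorem4p1 : ∃[ p ] ∃[ q ] (p ≥ 1 × q ≥ 1 ×
    ((t : ℕ) → t ≥ 1 →
    ∃[ a ] ∃[ b ] (a ≥ 1 × b ≥ 1 ×
    ((O : StrictTotalOrder 0ℓ 0ℓ 0ℓ) (n : ℕ) (G : QCGraph O t n) →
    Σ (Subset n) λ S →
    (IsClique O G S ⊎ IsIndependent O G S) ×
    AtLeastPow a b p q n ∣ S ∣))))
-- The exponent is 1/4 and alpha is 1/C. Matching `t` as a successor makes `t + t` nonzero by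
-- computation.
theorem4p1 = 1 , 4 , s≤s z≤n , s≤s z≤n , λ { t@(suc _) _ →
  let C , C≥1 , absorb = polylog-absorbed t _ in
  1 , C , s≤s z≤n , C≥1 , largeHomogeneousSet t C C≥1 absorb }
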